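{- Let $\Delta\ge 3$ and $c=0$ (palette $[\Delta]$). Any deterministic shift-based algorithm maintaining a proper $\Delta$-edge-coloring of an incremental forest of maximum degree at most $\Delta$ on $n$ vertices has, on some insertion sequence, amortized recourse $\Omega\!\left(\frac{1}{\Delta}\log\frac{n}{\Delta^3}\right)$.
   Context: A dynamic forest on $n$ fixed vertices starts empty; in the incremental model each update inserts an edge joining two distinct trees, with maximum degree always at most $\Delta$. Recourse of an update is the number of previously colored edges whose color changes; amortized recourse is total recourse divided by the number of updates. An algorithm is shift-based if upon each insertion it extends the coloring only by a chain of color shifts: starting with the new edge as the current uncolored edge $e'=(u,v)$, it assigns to $e'$ a color that is available (unused) at $u$ or at $v$; if the color is available at both endpoints the process ends, and otherwise the unique edge at the other endpoint having that color is uncolored and becomes the current uncolored edge. (In particular it never colors an edge by a color used at both of its endpoints.) -}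

module Defs where

open import Data.Nat using (ℕ; zero; suc; _+_; _≤_)
open import Data.Fin using (Fin; zero; suc; _≟_)
open import Data.List using (List; []; _∷_; length; lookup; filter)
open import Data.List.Membership.Propositional using (_∈_)
open import Data.Maybe using (Maybe; just; nothing)
open import Data.Product using (_×_; _,_; proj₁; proj₂; ∃)
open import Data.Sum using (_⊎_)
open import Relation.Binary.PropositionalEquality using (_≡_; _≢_)
open import Relation.Nullary using (¬_; yes; no; Dec)
open import Relation.Nullary.Decidable using (_⊎-dec_)

Edge : ℕ → Set
Edge n = Fin n × Fin n

-- A history: the list of inserted edges, MOST RECENT FIRST.
-- Edge positions in the history are indexed by Fin (length H).
History : ℕ → Set
History n = List (Edge n)

module _ {n : ℕ} where

  Incident : Edge n → Fin n → Set
  Incident e x = (proj₁ e ≡ x) ⊎ (proj₂ e ≡ x)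

  incident? : (x : Fin n) (e : Edge n) → Dec (Incident e x)
  incident? x e = (proj₁ e ≟ x) ⊎-dec (proj₂ e ≟ x)

  deg : History n → Fin n → ℕ
  deg E x = length (filter (incident? x) E)

  Ends : Edge n → Fin n → Fin n → Set
  Ends e x y = (proj₁ e ≡ x × proj₂ e ≡ y) ⊎ (proj₁ e ≡ y × proj₂ e ≡ x)

  data Connected (E : History n) : Fin n → Fin n → Set where
    here : ∀ {x} → Connected E x x
    step : ∀ {x y z} → (∃ λ e → e ∈ E × Ends e x y) → Connected E y z → Connected E x z

data ValidRun (n Δ : ℕ) : History n → Set where
  empty : ValidRun n Δ []
  insert : ∀ {H} (u v : Fin n) → ValidRun n Δ H →
           ¬ Connected H u v →
           deg ((u , v) ∷ H) u ≤ Δ → deg ((u , v) ∷ H) v ≤ Δ →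
           ValidRun n Δ ((u , v) ∷ H)

module _ {n Δ : ℕ} where

  Proper : (H : History n) → (Fin (length H) → Fin Δ) → Set
  Proper H g = ∀ i j → i ≢ j → ∀ x → Incident (lookup H i) x → Incident (lookup H j) x → g i ≢ g j

  upd : ∀ {k} → (Fin k → Maybe (Fin Δ)) → Fin k → Maybe (Fin Δ) → Fin k → Maybe (Fin Δ)
  upd f i a l with l ≟ i
  ... | yes _ = a
  ... | no _ = f l

  Avail : (E : History n) → (Fin (length E) → Maybe (Fin Δ)) → Fin Δ → Fin n → Set
  Avail E f c x = ∀ l → Incident (lookup E l) x → f l ≢ just c

  -- ShiftChain E f i g : starting from partial colouring f with current uncoloured
  -- edge i, a (finite) chain of colour shifts ends with the total colouring g.
  data ShiftChain (E : History n) :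
       (Fin (length E) → Maybe (Fin Δ)) → Fin (length E) → (Fin (length E) → Fin Δ) → Set where
    finish : ∀ {f i g} (c : Fin Δ) →
             Avail E f c (proj₁ (lookup E i)) → Avail E f c (proj₂ (lookup E i)) →
             (∀ l → upd f i (just c) l ≡ just (g l)) →
             ShiftChain E f i g
    shift  : ∀ {f i g} (c : Fin Δ) (x y : Fin n) → Ends (lookup E i) x y →
             Avail E f c x →
             (j : Fin (length E)) → Incident (lookup E j) y → f j ≡ just c →
             ShiftChain E (upd (upd f i (just c)) j nothing) j g →
             ShiftChain E f i g

  initial : ∀ {k} → (Fin k → Fin Δ) → Fin (suc k) → Maybe (Fin Δ)
  initial f zero = nothing
  initial f (suc l) = just (f l)

-- A deterministic shift-based algorithm: its colouring is a function of the
-- insertion history; it is proper on valid histories, and every insertion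
-- is realised by a shift chain starting at the new edge.
record ShiftAlg (n Δ : ℕ) : Set where
  field
    col    : (H : History n) → Fin (length H) → Fin Δ
    proper : ∀ H → ValidRun n Δ H → Proper H (col H)
    shifts : ∀ e H → ValidRun n Δ (e ∷ H) →
             ShiftChain {n} {Δ} (e ∷ H) (initial {n} {Δ} (col H)) zero (col (e ∷ H))

countDiff : ∀ {Δ} (k : ℕ) → (Fin k → Fin Δ) → (Fin k → Fin Δ) → ℕ
countDiff zero g f = 0
countDiff (suc k) g f with g zero ≟ f zero
... | yes _ = countDiff k (λ l → g (suc l)) (λ l → f (suc l))
... | no _ = suc (countDiff k (λ l → g (suc l)) (λ l → f (suc l)))

totalRecourse : ∀ {n Δ} → ShiftAlg n Δ → History n → ℕ
totalRecourse A [] = 0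
totalRecourse A (e ∷ H) =
  countDiff (length H) (λ l → ShiftAlg.col A (e ∷ H) (suc l)) (ShiftAlg.col A H)
  + totalRecourse A H

{-# OPTIONS --safe #-}
-- Build stars with Δ − 2 leaves. Each centre then misses a pair of colours, and if centres with the
-- same missing pair are linked into paths, a chain of shifts can only use these two colours on the
-- path edges: leaves are never recoloured and every path alternates between its two colours.
-- An alternating path with an even number of edges has different colours at its two ends, so two
-- such paths can always be linked at ends whose edges differ in colour; then one of them must be
-- recoloured completely. Doubling the length k times forces about k 2^k recolourings on 2^k stars.
-- With 2 Δ² s stars, the pigeonhole principle on the Δ² pairs yields Δ² disjoint groups of s stars
-- with a common missing pair, that is, half of all stars.
module Submission where

open import Defs
open import Data.Bool using (Bool; true; false; not; _xor_) renaming (_≟_ to _≟ᵇ_)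
open import Data.Bool.Properties using (¬-not; not-¬; not-involutive)
open import Data.Empty using (⊥-elim)
open import Data.Fin using (Fin; zero; suc; toℕ; combine; inject≤; _≟_)
open import Data.Fin.Properties using (any?; ¬∀⟶∃¬; injective⇒≤; suc-injective; toℕ<n; toℕ-injective; combine-injective; inject≤-injective)
open import Data.List using (List; []; _∷_; _++_; [_]; length; lookup; map; filter; take; drop; allFin; cartesianProduct)
open import Data.List.Properties using (length-map; length-++; length-tabulate; filter-accept; filter-reject; filter-none; take++drop≡id; length-take; length-drop; map-++; map-∘)
open import Data.List.Membership.Propositional using (_∈_; _∉_)
open import Data.List.Membership.Propositional.Properties using (∈-++⁺ˡ; ∈-++⁺ʳ; ∈-++⁻; ∈-map⁺; ∈-map⁻; ∈-lookup; ∈-allFin; ∈-cartesianProduct⁺)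
open import Data.List.Relation.Binary.Disjoint.Propositional using (Disjoint)
open import Data.List.Relation.Binary.Permutation.Propositional using (_↭_; ↭-refl; ↭-sym; ↭-trans; prep; ↭⇒↭ₛ)
open import Data.List.Relation.Binary.Permutation.Propositional.Properties using (∈-resp-↭; ↭-length; All-resp-↭; ++⁺ˡ; ++⁺ʳ; ++-comm; ++-assoc) renaming (shift to ↭-shift)
import Data.List.Relation.Binary.Permutation.Setoid.Properties as Permₛ
open import Data.List.Relation.Unary.All using (All; []; _∷_)
import Data.List.Relation.Unary.All as All
import Data.List.Relation.Unary.All.Properties as All
open import Data.List.Relation.Unary.Any using (Any; here; there; index)
import Data.List.Relation.Unary.Any as Any
import Data.List.Relation.Unary.Any.Properties as Any
open import Data.List.Relation.Unary.AllPairs using ([]; _∷_)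
open import Data.List.Relation.Unary.Unique.Propositional using (Unique)
import Data.List.Relation.Unary.Unique.Propositional.Properties as Unique
open import Data.Maybe using (Maybe; just; nothing)
open import Data.Maybe.Properties using (just-injective)
open import Data.Nat using (ℕ; zero; suc; _+_; _*_; _∸_; _^_; _≤_; _<_; z≤n; s≤s; _≤?_)
open import Data.Nat.Properties hiding (_≟_; suc-injective)
import Data.Nat.Properties as ℕ
open import Data.Nat.Tactic.RingSolver using (solve-∀)
open import Data.Product using (_×_; Σ; ∃; ∃₂; _,_; proj₁; proj₂; map₁; map₂)
open import Data.Sum using (_⊎_; inj₁; inj₂)
import Data.Sum as Sum
open import Function using (_∘_; id)
open import Relation.Binary.PropositionalEquality using (_≡_; _≢_; refl; sym; trans; cong; cong₂; subst; setoid)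
open import Relation.Nullary using (¬_; Dec; yes; no)
open import Relation.Unary using (Decidable)

-- Lists: duplicates, splittings and the pigeonhole principle.

module _ {A : Set} where

  lookup-injective : ∀ {xs : List A} → Unique xs → ∀ i j → lookup xs i ≡ lookup xs j → i ≡ j
  lookup-injective (x∉ ∷ u) zero    zero    eq = refl
  lookup-injective (x∉ ∷ u) zero    (suc j) eq = ⊥-elim (All.lookup x∉ (∈-lookup j) eq)
  lookup-injective (x∉ ∷ u) (suc i) zero    eq = ⊥-elim (All.lookup x∉ (∈-lookup i) (sym eq))
  lookup-injective (x∉ ∷ u) (suc i) (suc j) eq = cong suc (lookup-injective u i j eq)

  ∈⇒lookup : ∀ {x : A} {xs} → x ∈ xs → ∃ λ l → lookup xs l ≡ x
  ∈⇒lookup x∈ = index x∈ , sym (Any.lookup-index x∈)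

  Unique-resp-↭ : ∀ {xs ys : List A} → xs ↭ ys → Unique xs → Unique ys
  Unique-resp-↭ xs↭ys = Permₛ.Unique-resp-↭ (setoid A) (↭⇒↭ₛ xs↭ys)

  Unique-++⁻ : ∀ (xs : List A) {ys} → Unique (xs ++ ys) → Unique xs × Unique ys × Disjoint xs ys
  Unique-++⁻ []       u        = [] , u , λ { (() , _) }
  Unique-++⁻ (x ∷ xs) (x∉ ∷ u) with Unique-++⁻ xs u
  ... | uxs , uys , dis = All.++⁻ˡ xs x∉ ∷ uxs , uys ,
    λ { (here refl , y∈) → All.lookup (All.++⁻ʳ xs x∉) y∈ refl
      ; (there x∈  , y∈) → dis (x∈ , y∈) }

  length-cartesianProduct : ∀ {B : Set} (xs : List A) (ys : List B) →
    length (cartesianProduct xs ys) ≡ length xs * length ys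
  length-cartesianProduct []       ys = refl
  length-cartesianProduct (x ∷ xs) ys = trans (length-++ (map (x ,_) ys))
    (cong₂ _+_ (length-map (x ,_) ys) (length-cartesianProduct xs ys))

  split-length : ∀ a (xs : List A) → a ≤ length xs →
    ∃₂ λ ys zs → xs ≡ ys ++ zs × length ys ≡ a × length zs ≡ length xs ∸ a
  split-length a xs a≤ = take a xs , drop a xs , sym (take++drop≡id a xs) ,
    trans (length-take a xs) (m≤n⇒m⊓n≡m a≤) , length-drop a xs

  split-by : ∀ {P : A → Set} → Decidable P → ∀ xs →
    ∃₂ λ ys zs → xs ↭ ys ++ zs × All P ys × All (¬_ ∘ P) zs
  split-by P? [] = [] , [] , ↭-refl , [] , []
  split-by P? (x ∷ xs) with split-by P? xs | P? x
  ... | ys , zs , perm , pys , pzs | yes px = x ∷ ys , zs , prep x perm , px ∷ pys , pzs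
  ... | ys , zs , perm , pys , pzs | no ¬px =
    ys , x ∷ zs , ↭-trans (prep x perm) (↭-sym (↭-shift x ys zs)) , pys , ¬px ∷ pzs

  -- Induction on the number of values: if at most `s` elements take the top value `N`, discarding
  -- them leaves more than `N * s` elements with only `N` values. The conclusion is a splitting up
  -- to permutation, so that the remainder `zs` stays available for further groups.
  pigeonhole-↭ : ∀ N (f : A → ℕ) s xs → All (λ x → f x < N) xs → N * s < length xs →
    ∃ λ c → ∃₂ λ ys zs → xs ↭ ys ++ zs × length ys ≡ suc s × All (λ x → f x ≡ c) ys
  pigeonhole-↭ zero    f s (x ∷ xs) (() ∷ _) _
  pigeonhole-↭ (suc N) f s xs       f<       big
    with split-by (λ x → f x ℕ.≟ N) xs
  ... | ys , zs , perm , f≡ , f≢ with suc s ≤? length ys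
  ...   | yes s< with split-length (suc s) ys s<
  ...     | ys₁ , ys₂ , refl , len , _ =
    N , ys₁ , ys₂ ++ zs , ↭-trans perm (++-assoc ys₁ ys₂ zs) , len , All.++⁻ˡ ys₁ f≡
  pigeonhole-↭ (suc N) f s xs f< big | ys , zs , perm , f≡ , f≢ | no s≮
    with pigeonhole-↭ N f s zs
           (All.zipWith (λ { (fx<1+N , fx≢N) → ≤∧≢⇒< (≤-pred fx<1+N) fx≢N })
             (All.++⁻ʳ ys (All-resp-↭ perm f<) , f≢))
           (+-cancelˡ-< s _ _ (<-≤-trans big (begin
             length xs               ≡⟨ ↭-length perm ⟩
             length (ys ++ zs)       ≡⟨ length-++ ys ⟩
             length ys + length zs   ≤⟨ +-monoˡ-≤ (length zs) (≤-pred (≰⇒> s≮)) ⟩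
             s + length zs           ∎)))
    where open ≤-Reasoning
  ... | c , vs , ws , perm′ , len , f≡c = c , vs , ys ++ ws ,
    ↭-trans perm (↭-trans (++⁺ˡ ys perm′)
      (↭-trans (↭-sym (++-assoc ys vs ws)) (↭-trans (++⁺ʳ ws (++-comm ys vs)) (++-assoc vs ys ws)))) ,
    len , f≡c

-- Injections between finite sets and the pair of missing colours.

Injective : ∀ {k N} → (Fin k → Fin N) → Set
Injective f = ∀ {i j} → f i ≡ f j → i ≡ j

extend : ∀ {k N} → Fin N → (Fin k → Fin N) → Fin (suc k) → Fin N
extend c f zero    = c
extend c f (suc j) = f j

extend-injective : ∀ {k N} c (f : Fin k → Fin N) → Injective f → (∀ j → f j ≢ c) → Injective (extend c f)
extend-injective c f inj c∉ {zero}  {zero}  eq = refl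
extend-injective c f inj c∉ {zero}  {suc j} eq = ⊥-elim (c∉ j (sym eq))
extend-injective c f inj c∉ {suc i} {zero}  eq = ⊥-elim (c∉ i eq)
extend-injective c f inj c∉ {suc i} {suc j} eq = cong suc (inj eq)

unhit : ∀ {k N} (f : Fin k → Fin N) → k < N → ∃ λ c → ∀ j → f j ≢ c
unhit {k} {N} f k<N with ¬∀⟶∃¬ N (λ c → ∃ λ j → f j ≡ c) (λ c → any? (λ j → f j ≟ c))
                      (λ all → <⇒≱ k<N (injective⇒≤ {f = λ c → proj₁ (all c)}
                         (λ {c} {c′} eq → trans (sym (proj₂ (all c))) (trans (cong f eq) (proj₂ (all c′))))))
... | c , c∉ = c , λ j eq → c∉ (j , eq)

hit : ∀ {k N} (f : Fin k → Fin N) → Injective f → N ≤ k → ∀ c → ∃ λ j → f j ≡ c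
hit f inj N≤k c with any? (λ j → f j ≟ c)
... | yes c∈ = c∈
... | no  c∉ = ⊥-elim (≤⇒≯ N≤k (injective⇒≤ (extend-injective c f inj (λ j eq → c∉ (j , eq)))))

-- Boolean indices turn the exchange of the two colours into `not` and alternation along a path into
-- `xor`.
pick : ∀ {N} → Fin N × Fin N → Bool → Fin N
pick (a , b) true  = a
pick (a , b) false = b

-- Two applications of `unhit` give two colours outside the image. Adding them to `f` makes an
-- injection of `Fin (2 + p)` into itself, which is onto, so no third colour is missing.
complement-pair : ∀ {p} (f : Fin p → Fin (suc (suc p))) → Injective f →
  ∃ λ C → (∀ j t → f j ≢ pick C t) × (∀ {t t′} → pick C t ≡ pick C t′ → t ≡ t′) ×
          (∀ c → (∃ λ t → c ≡ pick C t) ⊎ (∃ λ j → c ≡ f j))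
complement-pair {p} f inj with unhit f (m≤n+m (suc p) 1)
... | a , a∉ with unhit (extend a f) ≤-refl
...   | b , b∉ = (a , b) , avoid , distinct , cover
  where
  avoid : ∀ j t → f j ≢ pick (a , b) t
  avoid j true  = a∉ j
  avoid j false = b∉ (suc j)
  distinct : ∀ {t t′} → pick (a , b) t ≡ pick (a , b) t′ → t ≡ t′
  distinct {true}  {true}  eq = refl
  distinct {true}  {false} eq = ⊥-elim (b∉ zero eq)
  distinct {false} {true}  eq = ⊥-elim (b∉ zero (sym eq))
  distinct {false} {false} eq = refl
  extended-injective : Injective (extend b (extend a f))
  extended-injective = extend-injective b (extend a f) (extend-injective a f inj a∉) b∉
  cover : ∀ c → (∃ λ t → c ≡ pick (a , b) t) ⊎ (∃ λ j → c ≡ f j)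
  cover c with hit (extend b (extend a f)) extended-injective ≤-refl c
  ... | zero        , eq = inj₁ (false , sym eq)
  ... | suc zero    , eq = inj₁ (true , sym eq)
  ... | suc (suc j) , eq = inj₂ (j , sym eq)

-- Lower bounds for the number of recoloured edges.

module _ {Δ : ℕ} where

  -- The number of differing positions before `l`. It embeds the differing positions into
  -- `Fin (countDiff k g f)`, so that the bound below becomes an injection between finite sets.
  rank : ∀ k (g f : Fin k → Fin Δ) l → g l ≢ f l → Fin (countDiff k g f)
  rank (suc k) g f l g≢f with g zero ≟ f zero
  rank (suc k) g f zero    g≢f | yes g≡f = ⊥-elim (g≢f g≡f)
  rank (suc k) g f (suc l) g≢f | yes _   = rank k (λ l → g (suc l)) (λ l → f (suc l)) l g≢f
  rank (suc k) g f zero    g≢f | no _    = zero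
  rank (suc k) g f (suc l) g≢f | no _    = suc (rank k (λ l → g (suc l)) (λ l → f (suc l)) l g≢f)

  rank-injective : ∀ k (g f : Fin k → Fin Δ) l l′ d d′ → rank k g f l d ≡ rank k g f l′ d′ → l ≡ l′
  rank-injective (suc k) g f l l′ d d′ eq with g zero ≟ f zero
  rank-injective (suc k) g f zero    l′       d d′ eq | yes g≡f = ⊥-elim (d g≡f)
  rank-injective (suc k) g f (suc l) zero     d d′ eq | yes g≡f = ⊥-elim (d′ g≡f)
  rank-injective (suc k) g f (suc l) (suc l′) d d′ eq | yes _   = cong suc (rank-injective k _ _ l l′ d d′ eq)
  rank-injective (suc k) g f zero    zero     d d′ eq | no _    = refl
  rank-injective (suc k) g f (suc l) (suc l′) d d′ eq | no _    =
    cong suc (rank-injective k _ _ l l′ d d′ (suc-injective eq))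

  countDiff-≥ : ∀ {k} (g f : Fin k → Fin Δ) ls → Unique ls → All (λ l → g l ≢ f l) ls →
    length ls ≤ countDiff k g f
  countDiff-≥ {k} g f ls u diff = injective⇒≤
    {f = λ i → rank k g f (lookup ls i) (All.lookup diff (∈-lookup i))}
    (λ {i} {j} eq → lookup-injective u i j (rank-injective k g f _ _ _ _ eq))

-- Degrees, isolated vertices and updates.

module _ {n : ℕ} where

  deg-skip : ∀ e (H : History n) x → ¬ Incident e x → deg (e ∷ H) x ≡ deg H x
  deg-skip e H x ¬inc = cong length (filter-reject (incident? x) ¬inc)

  deg-step : ∀ e (H : History n) x → deg (e ∷ H) x ≤ suc (deg H x)
  deg-step e H x with incident? x e
  ... | yes inc = ≤-reflexive (cong length (filter-accept (incident? x) inc))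
  ... | no ¬inc = ≤-trans (≤-reflexive (deg-skip e H x ¬inc)) (n≤1+n _)

  deg-isolated : ∀ (H : History n) x → (∀ {e} → e ∈ H → ¬ Incident e x) → deg H x ≡ 0
  deg-isolated H x iso = cong length (filter-none (incident? x) (All.tabulate iso))

  Ends⇒Incidentʳ : ∀ {e : Edge n} {x y} → Ends e x y → Incident e y
  Ends⇒Incidentʳ (inj₁ (_ , eq)) = inj₂ eq
  Ends⇒Incidentʳ (inj₂ (eq , _)) = inj₁ eq

  isolated-connected : ∀ {H : History n} {x y} → (∀ {e} → e ∈ H → ¬ Incident e y) →
    Connected H x y → x ≡ y
  isolated-connected iso here = refl
  isolated-connected iso (step (e , e∈ , ends) rest) with isolated-connected iso rest
  ... | refl = ⊥-elim (iso e∈ (Ends⇒Incidentʳ ends))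

  upd-other : ∀ {Δ k} (f : Fin k → Maybe (Fin Δ)) i a l → l ≢ i → upd {n} f i a l ≡ f l
  upd-other f i a l l≢i with l ≟ i
  ... | yes eq = ⊥-elim (l≢i eq)
  ... | no _   = refl

-- Sizes of the paths and the recourse that they force.

-- A path of level k + 1 joins two paths of level k and one more star: the extra star keeps the
-- number of edges even, so that the two end edges of a path have different colours.
stars : ℕ → ℕ
stars zero    = 1
stars (suc k) = suc (stars k + stars k)

edges : ℕ → ℕ
edges zero    = 0
edges (suc k) = suc (suc (edges k + edges k))

-- Two paths of level `k` are built, and one of them is recoloured completely when they are joined;
-- attaching the extra star is credited with nothing.
forced : ℕ → ℕ
forced zero    = 0
forced (suc k) = edges k + (forced k + forced k)

stars≡1+edges : ∀ k → stars k ≡ suc (edges k)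
stars≡1+edges zero    = refl
stars≡1+edges (suc k) = cong suc (trans (cong₂ _+_ (stars≡1+edges k) (stars≡1+edges k))
  (cong suc (+-suc (edges k) (edges k))))

edges+2 : ∀ k → edges k + 2 ≡ 2 ^ suc k
edges+2 zero    = refl
edges+2 (suc k) = trans (arith (edges k)) (cong (2 *_) (edges+2 k))
  where
  arith : ∀ x → suc (suc (x + x)) + 2 ≡ 2 * (x + 2)
  arith = solve-∀

stars≤ : ∀ k → stars k ≤ 2 ^ suc k
stars≤ k = begin
  stars k          ≡⟨ stars≡1+edges k ⟩
  1 + edges k      ≤⟨ n≤1+n _ ⟩
  2 + edges k      ≡⟨ +-comm 2 (edges k) ⟩
  edges k + 2      ≡⟨ edges+2 k ⟩
  2 ^ suc k        ∎
  where open ≤-Reasoning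

-- The bound is the closed form `(K - 2) * 2 ^ K + 2` of `forced K`, written with `K = 2 + k` to
-- avoid truncated subtraction.
forced≥ : ∀ k → k * 2 ^ (2 + k) + 2 ≤ forced (2 + k)
forced≥ zero    = ≤-refl
-- With 2 added on both sides, `edges+2` can replace `edges (2 + k) + 2` by a power of two.
forced≥ (suc k) = +-cancelʳ-≤ 2 _ _ (begin
  suc k * (2 * P) + 2 + 2                       ≡⟨ arith k P ⟩
  2 * P + ((k * P + 2) + (k * P + 2))           ≤⟨ +-monoʳ-≤ (2 * P) (+-mono-≤ (forced≥ k) (forced≥ k)) ⟩
  2 * P + (F + F)                               ≡⟨ cong (_+ (F + F)) (edges+2 (2 + k)) ⟨
  edges (2 + k) + 2 + (F + F)                   ≡⟨ arith′ (edges (2 + k)) (F + F) ⟩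
  edges (2 + k) + (F + F) + 2                   ∎)
  where
  open ≤-Reasoning
  P F : ℕ
  P = 2 ^ (2 + k)
  F = forced (2 + k)
  arith : ∀ k P → suc k * (2 * P) + 2 + 2 ≡ 2 * P + ((k * P + 2) + (k * P + 2))
  arith = solve-∀
  arith′ : ∀ x y → x + 2 + y ≡ x + y + 2
  arith′ = solve-∀

-- Disjoint stars and unions of components.

module Adversary {n p m : ℕ} (A : ShiftAlg n (suc (suc p)))
  (vtx : Fin m → Fin (suc p) → Fin n)
  (vtx-injective : ∀ {i i′ j j′} → vtx i j ≡ vtx i′ j′ → i ≡ i′ × j ≡ j′) where

  open ShiftAlg A

  Δ : ℕ
  Δ = suc (suc p)

  -- Row `i` of `vtx` lists the `Δ - 1` vertices of one star: index zero is the centre, the others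
  -- are its `p = Δ - 2` leaves.
  ctr : Fin m → Fin n
  ctr i = vtx i zero

  leaf : Fin m → Fin p → Edge n
  leaf i j = ctr i , vtx i (suc j)

  ctr-injective : ∀ {i i′} → ctr i ≡ ctr i′ → i ≡ i′
  ctr-injective eq = proj₁ (vtx-injective eq)

  leaf-injective : ∀ {i i′ j j′} → leaf i j ≡ leaf i′ j′ → i ≡ i′ × j ≡ j′
  leaf-injective eq with vtx-injective (cong proj₂ eq)
  ... | refl , refl = refl , refl

  leaf-incident : ∀ {i i′ j} → Incident (leaf i j) (ctr i′) → i ≡ i′
  leaf-incident (inj₁ eq) = ctr-injective eq
  leaf-incident (inj₂ eq) = proj₁ (vtx-injective eq)

  ctrs≢leaf : ∀ {i i′ k j} → (ctr i , ctr i′) ≢ leaf k j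
  ctrs≢leaf eq with vtx-injective (cong proj₂ eq)
  ... | _ , ()

  _within_ : Fin n → List (Fin m) → Set
  x within I = ∃₂ λ i j → i ∈ I × x ≡ vtx i j

  within⇒∈ : ∀ {i j I} → vtx i j within I → i ∈ I
  within⇒∈ (i , j , i∈ , eq) with vtx-injective eq
  ... | refl , refl = i∈

  ∈⇒within : ∀ {i j I} → i ∈ I → vtx i j within I
  ∈⇒within i∈ = _ , _ , i∈ , refl

  within-++⁺ˡ : ∀ {x I J} → x within I → x within (I ++ J)
  within-++⁺ˡ (i , j , i∈ , eq) = i , j , ∈-++⁺ˡ i∈ , eq

  within-++⁺ʳ : ∀ {x} I {J} → x within J → x within (I ++ J)
  within-++⁺ʳ I (i , j , i∈ , eq) = i , j , ∈-++⁺ʳ I i∈ , eq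

  within-++⁻ : ∀ {x} I {J} → x within (I ++ J) → x within I ⊎ x within J
  within-++⁻ I (i , j , i∈ , eq) with ∈-++⁻ I i∈
  ... | inj₁ i∈I = inj₁ (i , j , i∈I , eq)
  ... | inj₂ i∈J = inj₂ (i , j , i∈J , eq)

  within-disjoint : ∀ {x I J} → Disjoint I J → x within I → ¬ x within J
  within-disjoint dis (i , j , i∈ , refl) x∈J = dis (i∈ , within⇒∈ x∈J)

  -- No edge crosses the boundary of `I`. By `closed-connected`, paths on disjoint closed sets then
  -- lie in different trees, so joining them creates no cycle.
  Closed : History n → List (Fin m) → Set
  Closed H I = ∀ {e} → e ∈ H →
    (proj₁ e within I → proj₂ e within I) × (proj₂ e within I → proj₁ e within I)

  closed-connected : ∀ {H I x y} → Closed H I → Connected H x y → x within I → y within I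
  closed-connected cl here x∈ = x∈
  closed-connected cl (step (e , e∈ , inj₁ (refl , refl)) rest) x∈ =
    closed-connected cl rest (proj₁ (cl e∈) x∈)
  closed-connected cl (step (e , e∈ , inj₂ (refl , refl)) rest) x∈ =
    closed-connected cl rest (proj₂ (cl e∈) x∈)

  closed-skip : ∀ {H I i i′} → i ∉ I → i′ ∉ I → Closed H I → Closed ((ctr i , ctr i′) ∷ H) I
  closed-skip i∉ i′∉ cl (here refl) = (λ x∈ → ⊥-elim (i∉ (within⇒∈ x∈))) , (λ x∈ → ⊥-elim (i′∉ (within⇒∈ x∈)))
  closed-skip i∉ i′∉ cl (there e∈)  = cl e∈

  closed-join : ∀ {H I J i i′} → i ∈ I → i′ ∈ J → Closed H I → Closed H J →
    Closed ((ctr i , ctr i′) ∷ H) (I ++ J)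
  closed-join {I = I} i∈ i′∈ clI clJ (here refl) =
    (λ _ → ∈⇒within (∈-++⁺ʳ I i′∈)) , (λ _ → ∈⇒within (∈-++⁺ˡ i∈))
  closed-join {I = I} i∈ i′∈ clI clJ (there e∈) =
    (λ x∈ → Sum.[ within-++⁺ˡ ∘ proj₁ (clI e∈) , within-++⁺ʳ I ∘ proj₁ (clJ e∈) ] (within-++⁻ I x∈)) ,
    (λ x∈ → Sum.[ within-++⁺ˡ ∘ proj₂ (clI e∈) , within-++⁺ʳ I ∘ proj₂ (clJ e∈) ] (within-++⁻ I x∈))

  ctrs-incident : ∀ {i i′ k} → Incident (ctr i , ctr i′) (ctr k) → k ≡ i ⊎ k ≡ i′
  ctrs-incident (inj₁ eq) = inj₁ (sym (ctr-injective eq))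
  ctrs-incident (inj₂ eq) = inj₂ (sym (ctr-injective eq))

  -- Colourings with frozen leaves.

  -- A star with a fixed leaf colouring κ i misses exactly the two colours of pal i.
  module Spines (κ : Fin m → Fin p → Fin Δ) (pal : Fin m → Fin Δ × Fin Δ)
    (κ-avoids : ∀ i j t → κ i j ≢ pick (pal i) t)
    (pal-distinct : ∀ i {t t′} → pick (pal i) t ≡ pick (pal i) t′ → t ≡ t′)
    (κ-covers : ∀ i c → (∃ λ t → c ≡ pick (pal i) t) ⊎ (∃ λ j → c ≡ κ i j)) where

    Frozen : (H : History n) → (Fin (length H) → Fin Δ) → Set
    Frozen H g = ∀ l i j → lookup H l ≡ leaf i j → g l ≡ κ i j

    -- Deliberately not tied to `col H`: by `good-tail`, a good colouring after further insertions
    -- restricts to a good colouring of `H`, so statements about all good colourings survive these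
    -- insertions.
    Good : (H : History n) → (Fin (length H) → Fin Δ) → Set
    Good H g = Proper {n} {Δ} H g × Frozen H g

    good-tail : ∀ {e H g} → Good (e ∷ H) g → Good H (g ∘ suc)
    good-tail (prop , frz) =
      (λ i j i≢j → prop (suc i) (suc j) (i≢j ∘ suc-injective)) , (λ l → frz (suc l))

    Spine : Edge n → Set
    Spine e = ∃₂ λ i i′ → e ≡ (ctr i , ctr i′) × pal i ≡ pal i′

    record State (H : History n) : Set where
      field
        valid  : ValidRun n Δ H
        leaves : ∀ i j → leaf i j ∈ H
        frozen : Frozen H (col H)
        kinds  : ∀ {e} → e ∈ H → (∃₂ λ i j → e ≡ leaf i j) ⊎ Spine e

      good : Good H (col H)
      good = proper H valid , frozen

    -- Every colour outside the missing pair already occurs on a leaf edge at the centre, and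
    -- properness excludes it.
    spine-colour : ∀ {H g} → (∀ i j → leaf i j ∈ H) → Good H g → ∀ l i →
      Incident (lookup H l) (ctr i) → (∀ k j → lookup H l ≢ leaf k j) → ∃ λ t → g l ≡ pick (pal i) t
    spine-colour {H} {g} leaves (prop , frz) l i inc ¬leaf with κ-covers i (g l)
    ... | inj₁ free = free
    ... | inj₂ (j , eq) with ∈⇒lookup (leaves i j)
    ...   | l′ , at = ⊥-elim (prop l l′ (λ { refl → ¬leaf i j at }) (ctr i) inc
                       (subst (λ e → Incident e (ctr i)) (sym at) (inj₁ refl))
                       (trans eq (sym (frz l′ i j at))))

    -- Every colour available at the centre of a star is one of its two missing colours, and edges
    -- of these colours at a star with the same missing colours are spine edges: a chain of shifts
    -- that starts at a spine edge never reaches a leaf.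
    chain-frozen : ∀ {E f cur g} → (∀ i j → leaf i j ∈ E) →
      (∀ {e} → e ∈ E → (∃₂ λ i j → e ≡ leaf i j) ⊎ Spine e) →
      (∀ l i j → lookup E l ≡ leaf i j → f l ≡ just (κ i j)) →
      Spine (lookup E cur) → ShiftChain {n} {Δ} E f cur g → Frozen E g
    chain-frozen {E} {f} {cur} leaves kinds frz (u , v , at , _) (finish c _ _ total) l i j at′ =
      just-injective (trans (sym (total l)) (trans
        (upd-other {n} f cur (just c) l (λ { refl → ctrs≢leaf (trans (sym at) at′) })) (frz l i j at′)))
    chain-frozen {E} {f} {cur} {g} leaves kinds frz (u , v , at , same) (shift c x y ends avail k inc fk≡c rest)
      = go (ends′ ends)
      where
      ends′ : Ends (lookup E cur) x y → ∃₂ λ i i′ → x ≡ ctr i × y ≡ ctr i′ × pal i ≡ pal i′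
      ends′ (inj₁ (refl , refl)) = u , v , cong proj₁ at , cong proj₂ at , same
      ends′ (inj₂ (refl , refl)) = v , u , cong proj₂ at , cong proj₁ at , sym same
      go : (∃₂ λ i i′ → x ≡ ctr i × y ≡ ctr i′ × pal i ≡ pal i′) → Frozen E g
      go (i , i′ , refl , refl , same′) = by-kind (kinds (∈-lookup {xs = E} k))
        where
        free : ∃ λ t → c ≡ pick (pal i) t
        free with κ-covers i c
        ... | inj₁ t = t
        ... | inj₂ (j , refl) with ∈⇒lookup (leaves i j)
        ...   | l , at′ = ⊥-elim (avail l (subst (λ e → Incident e (ctr i)) (sym at′) (inj₁ refl)) (frz l i j at′))
        by-kind : (∃₂ λ k′ j → lookup E k ≡ leaf k′ j) ⊎ Spine (lookup E k) → Frozen E g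
        by-kind (inj₁ (k′ , j , at′)) with leaf-incident (subst (λ e → Incident e (ctr i′)) at′ inc)
        ... | refl = ⊥-elim (κ-avoids k′ j (proj₁ free)
                (trans (just-injective (trans (sym (frz k k′ j at′)) fk≡c))
                       (trans (proj₂ free) (cong (λ C → pick C (proj₁ free)) same′))))
        by-kind (inj₂ sp@(_ , _ , at′ , _)) = chain-frozen leaves kinds
          (λ l a b at″ → trans (upd-other {n} _ k nothing l (λ { refl → ctrs≢leaf (trans (sym at′) at″) }))
            (trans (upd-other {n} f cur (just c) l (λ { refl → ctrs≢leaf (trans (sym at) at″) })) (frz l a b at″)))
          sp rest

    -- The only place where `shifts` enters: the chain starts at an edge between centres with one
    -- missing pair, so `chain-frozen` preserves the leaf colours.
    link : ∀ {H} u v → State H → pal u ≡ pal v → ¬ Connected H (ctr u) (ctr v) →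
      deg H (ctr u) ≤ suc p → deg H (ctr v) ≤ suc p → State ((ctr u , ctr v) ∷ H)
    link {H} u v S same ¬conn du dv = record
      { valid  = valid′
      ; leaves = λ i j → there (State.leaves S i j)
      ; frozen = chain-frozen (λ i j → there (State.leaves S i j)) kinds′ start (u , v , refl , same)
                   (shifts _ H valid′)
      ; kinds  = kinds′ }
      where
      valid′ : ValidRun n Δ ((ctr u , ctr v) ∷ H)
      valid′ = insert (ctr u) (ctr v) (State.valid S) ¬conn
        (≤-trans (deg-step (ctr u , ctr v) H _) (s≤s du)) (≤-trans (deg-step (ctr u , ctr v) H _) (s≤s dv))
      kinds′ : ∀ {e} → e ∈ (ctr u , ctr v) ∷ H → (∃₂ λ i j → e ≡ leaf i j) ⊎ Spine e
      kinds′ (here refl) = inj₂ (u , v , refl , same)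
      kinds′ (there e∈)  = State.kinds S e∈
      start : ∀ l i j → lookup ((ctr u , ctr v) ∷ H) l ≡ leaf i j → initial {n} {Δ} (col H) l ≡ just (κ i j)
      start zero    i j at = ⊥-elim (ctrs≢leaf at)
      start (suc l) i j at = cong just (State.frozen S l i j at)

    -- Alternating paths and their joins.

    Slots : History n → Set
    Slots H = List (Fin (length H) × Bool)

    -- Histories grow at the front, so each insertion renumbers the old positions by `suc`.
    lift : ∀ {k} → List (Fin k × Bool) → List (Fin (suc k) × Bool)
    lift = map (map₁ suc)

    Touches : (H : History n) → Fin m → Bool → Fin (length H) × Bool → Set
    Touches H u α (l , s) = Incident (lookup H l) (ctr u) × s ≡ α

    -- An end must still accept one more edge, hence the bound `suc p`, which is `Δ - 1`.
    record End (H : History n) (ls : Slots H) (u : Fin m) (α : Bool) : Set where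
      field
        degree : deg H (ctr u) ≤ suc p
        slot   : Any (Touches H u α) ls

    -- A single star is both ends of its path. An edge attached to it continues a virtual end label
    -- `α` with parity `not α` and at once becomes the end edge on the other side, which explains
    -- `β ≡ not α` and the stricter degree bound `p`.
    data Shape (H : History n) (ls : Slots H) (u v : Fin m) (α β : Bool) : Set where
      point : ls ≡ [] → u ≡ v → β ≡ not α → deg H (ctr u) ≤ p → Shape H ls u v α β
      line  : u ≢ v → End H ls u α → End H ls v β → Shape H ls u v α β

    -- `t` is the phase of the path: exchanging the two colours along the whole path negates it.
    Fits : ∀ {k} → Fin Δ × Fin Δ → (Fin k → Fin Δ) → Bool → Fin k × Bool → Set
    Fits C g t (l , s) = g l ≡ pick C (s xor t)

    -- A path with spine edges ls, each labelled by its parity; α and β label the end edges.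
    -- Up to the choice of t, the parities determine every good colouring of the path.
    record Path (H : History n) (C : Fin Δ × Fin Δ) (I : List (Fin m)) (α β : Bool) (d : ℕ) : Set where
      field
        u v    : Fin m
        u∈     : u ∈ I
        v∈     : v ∈ I
        ls     : Slots H
        size   : length ls ≡ d
        uniq   : Unique (map proj₁ ls)
        inside : All (λ q → proj₁ (lookup H (proj₁ q)) within I) ls
        closed : Closed H I
        ofPal  : All (λ i → pal i ≡ C) I
        rigid  : ∀ g → Good H g → ∃ λ t → All (Fits C g t) ls
        shape  : Shape H ls u v α β

      degree-u : deg H (ctr u) ≤ suc p
      degree-u with shape
      ... | point _ _ _ du = m≤n⇒m≤1+n du
      ... | line _ eu _    = End.degree eu

      pal-u : pal u ≡ C
      pal-u = All.lookup ofPal u∈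

    lift-unique : ∀ {k} (ls : List (Fin k × Bool)) → Unique (map proj₁ ls) → Unique (map proj₁ (lift ls))
    lift-unique ls u = subst Unique (trans (sym (map-∘ ls)) (map-∘ ls)) (Unique.map⁺ suc-injective u)

    untouched : ∀ {I i i′ k} → i ∉ I → i′ ∉ I → k ∈ I → ¬ Incident (ctr i , ctr i′) (ctr k)
    untouched i∉ i′∉ k∈ inc with ctrs-incident inc
    ... | inj₁ refl = i∉ k∈
    ... | inj₂ refl = i′∉ k∈

    weaken : ∀ {H C I α β d i i′} → i ∉ I → i′ ∉ I → Path H C I α β d → Path ((ctr i , ctr i′) ∷ H) C I α β d
    weaken {H} {I = I} {i = i} {i′ = i′} i∉ i′∉ P = record
      { u = u ; v = v ; u∈ = u∈ ; v∈ = v∈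
      ; ls     = lift ls
      ; size   = trans (length-map _ ls) size
      ; uniq   = lift-unique ls uniq
      ; inside = All.map⁺ inside
      ; closed = closed-skip i∉ i′∉ closed
      ; ofPal  = ofPal
      ; rigid  = λ g good → let t , fits = rigid (g ∘ suc) (good-tail good) in t , All.map⁺ fits
      ; shape  = shape′ shape }
      where
      open Path P
      same-degree : ∀ {k} → k ∈ I → deg ((ctr i , ctr i′) ∷ H) (ctr k) ≡ deg H (ctr k)
      same-degree k∈ = deg-skip (ctr i , ctr i′) H _ (untouched i∉ i′∉ k∈)
      end′ : ∀ {k γ} → k ∈ I → End H ls k γ → End ((ctr i , ctr i′) ∷ H) (lift ls) k γ
      end′ k∈ E = record { degree = ≤-trans (≤-reflexive (same-degree k∈)) (End.degree E)
                         ; slot   = Any.map⁺ (End.slot E) }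
      shape′ : ∀ {α β} → Shape H ls u v α β → Shape ((ctr i , ctr i′) ∷ H) (lift ls) u v α β
      shape′ (point ls≡[] u≡v β≡ du) =
        point (cong lift ls≡[]) u≡v β≡ (≤-trans (≤-reflexive (same-degree u∈)) du)
      shape′ (line u≢v eu ev) = line u≢v (end′ u∈ eu) (end′ v∈ ev)

    flip : ∀ {k} → List (Fin k × Bool) → List (Fin k × Bool)
    flip = map (map₂ not)

    not-xor-not : ∀ s t → not s xor not t ≡ s xor t
    not-xor-not false t = not-involutive t
    not-xor-not true  t = refl

    flip-fits : ∀ {k C t} {g : Fin k → Fin Δ} {ls} → All (Fits C g t) ls → All (Fits C g (not t)) (flip ls)
    flip-fits {C = C} {t} fits = All.map⁺ (All.map (λ { {l , s} eq →
      trans eq (cong (pick C) (sym (not-xor-not s t))) }) fits)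

    -- Besides swapping the ends, all parities are negated, which the phase absorbs. A `false`,
    -- `true` path thus keeps its labels but gets the opposite phase, and a `true`, `true` path
    -- becomes `false`, `false`, as joining requires.
    backwards : ∀ {H C I α β d} → Path H C I α β d → Path H C I (not β) (not α) d
    backwards {H} {I = I} P = record
      { u = v ; v = u ; u∈ = v∈ ; v∈ = u∈
      ; ls     = flip ls
      ; size   = trans (length-map _ ls) size
      ; uniq   = subst Unique (map-∘ ls) uniq
      ; inside = All.map⁺ inside
      ; closed = closed
      ; ofPal  = ofPal
      ; rigid  = λ g good → let t , fits = rigid g good in not t , flip-fits fits
      ; shape  = shape′ shape }
      where
      open Path P
      end′ : ∀ {k γ} → End H ls k γ → End H (flip ls) k (not γ)
      end′ E = record { degree = End.degree E
                      ; slot   = Any.map⁺ (Any.map (λ { (inc , eq) → inc , cong not eq }) (End.slot E)) }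
      shape′ : ∀ {α β} → Shape H ls u v α β → Shape H (flip ls) v u (not β) (not α)
      shape′ (point ls≡[] refl refl du) = point (cong flip ls≡[]) refl (sym (not-involutive _)) du
      shape′ (line u≢v eu ev)           = line (u≢v ∘ sym) (end′ ev) (end′ eu)

    -- A new edge at the end u sees there an end edge of parity false, so it continues the
    -- alternation with parity true.
    aligned : ∀ {H C I β d e t} (P : Path H C I false β d) (g : Fin (suc (length H)) → Fin Δ) →
      Good (e ∷ H) g → Incident e (ctr (Path.u P)) → g zero ≡ pick C (not t) →
      All (Fits C (g ∘ suc) t) (Path.ls P)
    aligned {C = C} {t = t} P g good inc g₀ with Path.rigid P (g ∘ suc) (good-tail good)
    ... | t′ , fits with Path.shape P
    ...   | point ls≡[] _ _ _ = subst (All _) (sym ls≡[]) []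
    ...   | line _ eu _ with All.lookupAny fits (End.slot eu)
    ...     | eq , inc′ , s≡ = subst (λ t → All (Fits C (g ∘ suc) t) (Path.ls P)) t′≡t fits
      where
      t′≡t : t′ ≡ t
      t′≡t = trans (¬-not λ t′≡ → proj₁ good zero (suc _) (λ ()) _ inc inc′
        (trans g₀ (trans (cong (pick C) (sym t′≡)) (trans (cong (λ s → pick C (s xor t′)) (sym s≡)) (sym eq)))))
        (not-involutive t)

    joined-end : ∀ {H C I β d e} (P : Path H C I false β d) → Incident e (ctr (Path.u P)) →
      (Path.u P ≢ Path.v P → ¬ Incident e (ctr (Path.v P))) →
      End (e ∷ H) ((zero , true) ∷ lift (Path.ls P)) (Path.v P) β
    joined-end {H} {e = e} P inc ¬inc with Path.shape P
    ... | point _ refl refl du = record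
      { degree = ≤-trans (deg-step e H _) (s≤s du) ; slot = here (inc , refl) }
    ... | line u≢v eu ev = record
      { degree = ≤-trans (≤-reflexive (deg-skip e H _ (¬inc u≢v))) (End.degree ev)
      ; slot   = there (Any.map⁺ (End.slot ev)) }

    -- Both paths are joined at ends labelled `false`, so the single parity `true` on the new edge
    -- continues both alternations, and its colour dictates the phase of both.
    module Join {H C I J β δ d d′} (S : State H) (I#J : Disjoint I J)
      (P : Path H C I false β d) (Q : Path H C J false δ d′) where

      private
        module P = Path P
        module Q = Path Q

      e : Edge n
      e = ctr P.u , ctr Q.u

      ¬conn : ¬ Connected H (ctr P.u) (ctr Q.u)
      ¬conn conn = I#J (within⇒∈ (closed-connected P.closed conn (∈⇒within P.u∈)) , Q.u∈)

      state : State (e ∷ H)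
      state = link P.u Q.u S (trans P.pal-u (sym Q.pal-u)) ¬conn P.degree-u Q.degree-u

      new-colour : ∀ g → Good (e ∷ H) g → ∃ λ t → g zero ≡ pick C (not t)
      new-colour g good with spine-colour (State.leaves state) good zero P.u (inj₁ refl) (λ _ _ → ctrs≢leaf)
      ... | t , eq = not t , trans eq (cong₂ pick P.pal-u (sym (not-involutive t)))

      slots : Slots (e ∷ H)
      slots = (zero , true) ∷ lift P.ls ++ lift Q.ls

      slots-unique : Unique (map proj₁ slots)
      slots-unique = All.tabulate (λ { {l} l∈ refl → fresh l∈ }) ∷
        subst Unique (sym (map-++ proj₁ (lift P.ls) (lift Q.ls)))
          (Unique.++⁺ (lift-unique P.ls P.uniq) (lift-unique Q.ls Q.uniq) disjoint)
        where
        lifted : ∀ {l} ls → l ∈ map proj₁ (lift ls) → ∃ λ q → q ∈ ls × l ≡ suc (proj₁ q)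
        lifted ls l∈ with ∈-map⁻ proj₁ l∈
        ... | _ , q∈ , refl with ∈-map⁻ (map₁ suc) q∈
        ...   | q , q∈′ , refl = q , q∈′ , refl
        fresh : zero ∉ map proj₁ (lift P.ls ++ lift Q.ls)
        fresh z∈ with ∈-++⁻ (map proj₁ (lift P.ls)) (subst (zero ∈_) (map-++ proj₁ (lift P.ls) (lift Q.ls)) z∈)
        ... | inj₁ z∈P with lifted P.ls z∈P
        ...   | _ , _ , ()
        fresh z∈ | inj₂ z∈Q with lifted Q.ls z∈Q
        ...   | _ , _ , ()
        disjoint : Disjoint (map proj₁ (lift P.ls)) (map proj₁ (lift Q.ls))
        -- A common position would be an edge whose first endpoint lies in stars of both `I` and
        -- `J`.
        disjoint (l∈P , l∈Q) with lifted P.ls l∈P | lifted Q.ls l∈Q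
        ... | q , q∈ , refl | (_ , _) , q′∈ , refl =
          within-disjoint I#J (All.lookup P.inside q∈) (All.lookup Q.inside q′∈)

      path : Path (e ∷ H) C (I ++ J) β δ (suc (d + d′))
      path = record
        { u = P.v ; v = Q.v ; u∈ = ∈-++⁺ˡ P.v∈ ; v∈ = ∈-++⁺ʳ I Q.v∈
        ; ls     = slots
        ; size   = cong suc (trans (length-++ (lift P.ls))
                     (cong₂ _+_ (trans (length-map _ P.ls) P.size) (trans (length-map _ Q.ls) Q.size)))
        ; uniq   = slots-unique
        ; inside = ∈⇒within (∈-++⁺ˡ P.u∈) ∷
                   All.++⁺ (All.map⁺ (All.map within-++⁺ˡ P.inside)) (All.map⁺ (All.map (within-++⁺ʳ I) Q.inside))
        ; closed = closed-join P.u∈ Q.u∈ P.closed Q.closed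
        ; ofPal  = All.++⁺ P.ofPal Q.ofPal
        -- `pick C (not t)` is the colour that parity `true` receives in phase `t`; by `aligned`
        -- both old paths have this phase.
        ; rigid  = λ g good → let t , g₀ = new-colour g good in
                   t , g₀ ∷ All.++⁺ (All.map⁺ (aligned P g good (inj₁ refl) g₀))
                                    (All.map⁺ (aligned Q g good (inj₂ refl) g₀))
        ; shape  = line (λ eq → I#J (P.v∈ , subst (_∈ J) (sym eq) Q.v∈))
                     (record { degree = End.degree endP ; slot = widenˡ (End.slot endP) })
                     (record { degree = End.degree endQ ; slot = widenʳ (End.slot endQ) }) }
        where
        ¬incP : P.u ≢ P.v → ¬ Incident e (ctr P.v)
        ¬incP u≢v inc with ctrs-incident inc
        ... | inj₁ v≡u = u≢v (sym v≡u)
        ... | inj₂ v≡u = I#J (subst (_∈ I) v≡u P.v∈ , Q.u∈)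
        ¬incQ : Q.u ≢ Q.v → ¬ Incident e (ctr Q.v)
        ¬incQ u≢v inc with ctrs-incident inc
        ... | inj₁ v≡u = I#J (P.u∈ , subst (_∈ J) v≡u Q.v∈)
        ... | inj₂ v≡u = u≢v (sym v≡u)
        endP : End (e ∷ H) ((zero , true) ∷ lift P.ls) P.v β
        endP = joined-end P (inj₁ refl) ¬incP
        endQ : End (e ∷ H) ((zero , true) ∷ lift Q.ls) Q.v δ
        endQ = joined-end Q (inj₂ refl) ¬incQ
        widenˡ : ∀ {T : Fin (suc (length H)) × Bool → Set} → Any T ((zero , true) ∷ lift P.ls) → Any T slots
        widenˡ (here x)  = here x
        widenˡ (there x) = there (Any.++⁺ˡ x)
        widenʳ : ∀ {T : Fin (suc (length H)) × Bool → Set} → Any T ((zero , true) ∷ lift Q.ls) → Any T slots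
        widenʳ (here x)  = here x
        widenʳ (there x) = there (Any.++⁺ʳ (lift P.ls) x)

      -- Different phases give different colours on every edge, whatever its parity, because `pick`
      -- is injective on the missing pair.
      flipped : ∀ {k} {g f : Fin k → Fin Δ} {s t} → s ≢ t → ∀ ls → Unique (map proj₁ ls) →
        All (Fits C g s) ls → All (Fits C f t) ls → length ls ≤ countDiff k g f
      flipped {k} {g} {f} {s} {t} s≢t ls u gs fs = subst (_≤ countDiff k g f) (length-map proj₁ ls)
        (countDiff-≥ g f (map proj₁ ls) u (All.map⁺ (All.zipWith
          (λ { {l , r} (eg , ef) eq → s≢t (xor-cancelˡ r (pal-distinct P.u
            (subst (λ D → pick D (r xor s) ≡ pick D (r xor t)) (sym P.pal-u) (trans (sym eg) (trans eq ef))))) }) (gs , fs))))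
        where
        xor-cancelˡ : ∀ r {s t} → r xor s ≡ r xor t → s ≡ t
        xor-cancelˡ false eq = eq
        xor-cancelˡ true {s} {t} eq = trans (sym (not-involutive s)) (trans (cong not eq) (not-involutive t))

      -- After the insertion both paths share the phase `s` of the new edge. Their old phases
      -- differ, so `s` differs from one of them, and that path is recoloured completely.
      recourse : d ≡ d′ → ∀ {t t′} → All (Fits C (col H) t) P.ls → All (Fits C (col H) t′) Q.ls → t ≢ t′ →
        d ≤ countDiff (length H) (λ l → col (e ∷ H) (suc l)) (col H)
      recourse d≡d′ {t} {t′} fitP fitQ t≢t′ with new-colour (col (e ∷ H)) (State.good state)
      ... | s , g₀ with s ≟ᵇ t
      ...   | no s≢t   = ≤-trans (≤-reflexive (sym P.size)) (flipped s≢t P.ls P.uniq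
                         (aligned P (col (e ∷ H)) (State.good state) (inj₁ refl) g₀) fitP)
      ...   | yes refl = ≤-trans (≤-reflexive (trans d≡d′ (sym Q.size))) (flipped t≢t′ Q.ls Q.uniq
                         (aligned Q (col (e ∷ H)) (State.good state) (inj₂ refl) g₀) fitQ)

    -- Long paths by repeated doubling.

    data Ext (J : List (Fin m)) (H : History n) : History n → Set where
      done : Ext J H H
      more : ∀ {H′ i i′} → i ∈ J → i′ ∈ J → Ext J H H′ → Ext J H ((ctr i , ctr i′) ∷ H′)

    ext-trans : ∀ {J H H′ H″} → Ext J H H′ → Ext J H′ H″ → Ext J H H″
    ext-trans ex done            = ex
    ext-trans ex (more i∈ i′∈ f) = more i∈ i′∈ (ext-trans ex f)

    ext-mono : ∀ {I J H H′} → (∀ {i} → i ∈ I → i ∈ J) → Ext I H H′ → Ext J H H′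
    ext-mono sub done             = done
    ext-mono sub (more i∈ i′∈ ex) = more (sub i∈) (sub i′∈) (ext-mono sub ex)

    -- `Ext` records which stars the new edges touch for this purpose: a path on other stars
    -- survives by one `weaken` per insertion.
    path-ext : ∀ {I J H H′ C α β d} → Disjoint I J → Ext J H H′ → Path H C I α β d → Path H′ C I α β d
    path-ext I#J done             P = P
    path-ext I#J (more i∈ i′∈ ex) P =
      weaken (λ i∈I → I#J (i∈I , i∈)) (λ i′∈I → I#J (i′∈I , i′∈)) (path-ext I#J ex P)

    Fresh : History n → Fin m → Set
    Fresh H i = deg H (ctr i) ≤ p × Closed H [ i ]

    fresh-ext : ∀ {i J H H′} → i ∉ J → Ext J H H′ → Fresh H i → Fresh H′ i
    fresh-ext i∉J done fr = fr
    fresh-ext {i} {H = H} i∉J (more {H′} {k} {k′} k∈ k′∈ ex) fr with fresh-ext i∉J ex fr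
    ... | du , cl = ≤-trans (≤-reflexive (deg-skip (ctr k , ctr k′) H′ (ctr i) (untouched k∉ k′∉ (here refl)))) du ,
                    closed-skip k∉ k′∉ cl
      where
      k∉ : k ∉ [ i ]
      k∉ (here refl) = i∉J k∈
      k′∉ : k′ ∉ [ i ]
      k′∉ (here refl) = i∉J k′∈

    single : ∀ {H C i} → pal i ≡ C → Fresh H i → Path H C [ i ] false true 0
    single {i = i} pal≡ (du , cl) = record
      { u = i ; v = i ; u∈ = here refl ; v∈ = here refl ; ls = [] ; size = refl ; uniq = [] ; inside = []
      -- Without edges every phase fits; `true` is an arbitrary choice.
      ; closed = cl ; ofPal = pal≡ ∷ [] ; rigid = λ _ _ → true , [] ; shape = point refl refl refl du }

    -- If the current phases differ, the end edges labelled `false` differ in colour and these ends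
    -- are joined. If they agree, reversing the second path negates its phase. Either way the
    -- remaining ends are both labelled `true`.
    double : ∀ {H C I J d} → State H → Disjoint I J → Path H C I false true d → Path H C J false true d →
      ∃ λ H′ → State H′ × Ext (I ++ J) H H′ × Path H′ C (I ++ J) true true (suc (d + d)) ×
        length H′ ≡ suc (length H) × d + totalRecourse A H ≤ totalRecourse A H′
    double {H} {I = I} S I#J P Q with Path.rigid P (col H) (State.good S) | Path.rigid Q (col H) (State.good S)
    ... | t , fitP | t′ , fitQ with t ≟ᵇ t′
    ...   | no t≢t′ = _ , J.state , more (∈-++⁺ˡ (Path.u∈ P)) (∈-++⁺ʳ I (Path.u∈ Q)) done , J.path , refl ,
      +-monoˡ-≤ (totalRecourse A H) (J.recourse refl fitP fitQ t≢t′)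
      where module J = Join S I#J P Q
    ...   | yes refl = _ , J.state , more (∈-++⁺ˡ (Path.u∈ P)) (∈-++⁺ʳ I (Path.v∈ Q)) done , J.path , refl ,
      +-monoˡ-≤ (totalRecourse A H) (J.recourse refl fitP (flip-fits fitQ) (not-¬ refl))
      where module J = Join S I#J P (backwards Q)

    -- Reversed, the path has labels `false`, `false`; the star contributes the end label `true`, so
    -- the labels differ again, as the next doubling needs.
    attach : ∀ {H C I i d} → State H → Disjoint I [ i ] → Path H C I true true d → Path H C [ i ] false true 0 →
      ∃ λ H′ → State H′ × Ext (I ++ [ i ]) H H′ × Path H′ C (I ++ [ i ]) false true (suc d) ×
        length H′ ≡ suc (length H) × totalRecourse A H ≤ totalRecourse A H′
    attach {H} {C} {I} {i} {d} S I#i P Q =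
      _ , J.state , more (∈-++⁺ˡ (Path.v∈ P)) (∈-++⁺ʳ I (Path.u∈ Q)) done ,
      subst (λ k → Path (J.e ∷ H) C (I ++ [ i ]) false true (suc k)) (+-identityʳ d) J.path , refl ,
      m≤n+m (totalRecourse A H) _
      where module J = Join S I#i (backwards P) Q

    -- The two halves are built one after the other. The first path and the extra star remain intact
    -- meanwhile, because all insertions in between stay within disjoint sets of stars.
    build : ∀ k {H C} I → length I ≡ stars k → Unique I → All (λ i → pal i ≡ C) I → State H →
      (∀ {i} → i ∈ I → Fresh H i) →
      ∃ λ H′ → State H′ × Ext I H H′ × Path H′ C I false true (edges k) ×
        length H′ ≡ edges k + length H × forced k + totalRecourse A H ≤ totalRecourse A H′
    build zero (i ∷ []) _ _ (pal≡ ∷ []) S fresh =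
      _ , S , done , single pal≡ (fresh (here refl)) , refl , ≤-refl
    build (suc k) {H} I len u ofPal S fresh
      with split-length (stars k + stars k) I (≤-trans (n≤1+n _) (≤-reflexive (sym len)))
    ... | I₁₂ , I₃ , refl , len₁₂ , len₃ with split-length (stars k) I₁₂ (≤-trans (m≤m+n _ _) (≤-reflexive (sym len₁₂)))
    ...   | I₁ , I₂ , refl , len₁ , len₂
      with Unique-++⁻ (I₁ ++ I₂) u | trans len₃ (trans (cong (_∸ (stars k + stars k)) len) (m+n∸n≡m 1 (stars k + stars k)))
    -- The third block has length one: it is the extra star `x`.
    build (suc k) {H} .((I₁ ++ I₂) ++ x ∷ []) len u ofPal S fresh
          | I₁₂ , (x ∷ []) , refl , len₁₂ , len₃ | I₁ , I₂ , refl , len₁ , len₂ | u₁₂ , _ , I₁₂#x | refl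
      with Unique-++⁻ I₁ u₁₂
    ... | u₁ , u₂ , I₁#I₂
      with build k I₁ len₁ u₁ (All.++⁻ˡ I₁ (All.++⁻ˡ (I₁ ++ I₂) ofPal)) S (λ i∈ → fresh (∈-++⁺ˡ (∈-++⁺ˡ i∈)))
    ... | H₁ , S₁ , ex₁ , P₁ , l₁ , r₁
      with build k I₂ (trans len₂ (trans (cong (_∸ stars k) len₁₂) (m+n∸n≡m (stars k) (stars k)))) u₂
             (All.++⁻ʳ I₁ (All.++⁻ˡ (I₁ ++ I₂) ofPal)) S₁
             (λ i∈ → fresh-ext (λ i∈₁ → I₁#I₂ (i∈₁ , i∈)) ex₁ (fresh (∈-++⁺ˡ (∈-++⁺ʳ I₁ i∈))))
    ... | H₂ , S₂ , ex₂ , P₂ , l₂ , r₂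
      with double S₂ I₁#I₂ (path-ext I₁#I₂ ex₂ P₁) P₂
    ... | H₃ , S₃ , ex₃ , P₃ , l₃ , r₃ = finalise
      (attach S₃ I₁₂#x P₃ (single (All.lookup ofPal (∈-++⁺ʳ (I₁ ++ I₂) (here refl)))
        (fresh-ext (λ x∈ → I₁₂#x (x∈ , here refl)) ext₁₂ (fresh (∈-++⁺ʳ (I₁ ++ I₂) (here refl))))))
      where
      ext₁₂ : Ext (I₁ ++ I₂) H H₃
      ext₁₂ = ext-trans (ext-mono ∈-++⁺ˡ ex₁) (ext-trans (ext-mono (∈-++⁺ʳ I₁) ex₂) ex₃)
      finalise : _ → _
      finalise (H₄ , S₄ , ex₄ , P₄ , l₄ , r₄) =
        H₄ , S₄ , ext-trans (ext-mono ∈-++⁺ˡ ext₁₂) ex₄ , P₄ ,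
        trans l₄ (cong suc (trans l₃ (cong suc (trans l₂ (trans (cong (edges k +_) l₁) (sym (+-assoc (edges k) (edges k) _))))))) ,
        (begin
          edges k + (forced k + forced k) + totalRecourse A H       ≡⟨ +-assoc (edges k) _ _ ⟩
          edges k + (forced k + forced k + totalRecourse A H)       ≡⟨ cong (edges k +_) (+-assoc (forced k) _ _) ⟩
          edges k + (forced k + (forced k + totalRecourse A H))     ≤⟨ +-monoʳ-≤ (edges k) (+-monoʳ-≤ (forced k) r₁) ⟩
          edges k + (forced k + totalRecourse A H₁)                 ≤⟨ +-monoʳ-≤ (edges k) r₂ ⟩
          edges k + totalRecourse A H₂                              ≤⟨ r₃ ⟩
          totalRecourse A H₃                                        ≤⟨ r₄ ⟩
          totalRecourse A H₄                                        ∎)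
        where open ≤-Reasoning

    -- Grouping the stars by their missing pairs.

    code : Fin m → ℕ
    code i = toℕ (combine (proj₁ (pal i)) (proj₂ (pal i)))

    code-injective : ∀ i i′ → code i ≡ code i′ → pal i ≡ pal i′
    code-injective i i′ eq with combine-injective _ _ _ _ (toℕ-injective eq)
    ... | eq₁ , eq₂ = cong₂ _,_ eq₁ eq₂

    same-palette : ∀ {c} I → All (λ i → code i ≡ c) I → ∀ {k} → length I ≡ suc k →
      ∃ λ C → All (λ i → pal i ≡ C) I
    same-palette (i ∷ I) (eq ∷ eqs) _ =
      pal i , refl ∷ All.map (λ {i′} eq′ → code-injective i′ i (trans eq′ (sym eq))) eqs

    -- Besides the `t * stars k` stars still to be used, a reserve of `Δ * Δ * stars k` stars is
    -- kept, so that some missing pair occurs often enough at every round. Each round uses up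
    -- exactly `stars k` stars and never touches the reserve bound.
    harvest : ∀ k t xs {H} → State H → Unique xs → (∀ {i} → i ∈ xs → Fresh H i) →
      t * stars k + Δ * Δ * stars k ≤ length xs →
      ∃ λ H′ → State H′ × length H′ ≡ t * edges k + length H ×
        t * forced k + totalRecourse A H ≤ totalRecourse A H′
    harvest k zero    xs {H} S u fresh enough = H , S , refl , ≤-refl
    harvest k (suc t) xs {H} S u fresh enough
      -- `edges k` is `stars k - 1`, and `pigeonhole-↭` returns one element more than its argument.
      with pigeonhole-↭ (Δ * Δ) code (edges k) xs (All.tabulate (λ _ → toℕ<n _)) (begin-strict
             Δ * Δ * edges k                                 ≤⟨ *-monoʳ-≤ (Δ * Δ) (n≤1+n (edges k)) ⟩
             Δ * Δ * suc (edges k)                           ≡⟨ cong (Δ * Δ *_) (stars≡1+edges k) ⟨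
             Δ * Δ * stars k                                 <⟨ s≤s (m≤n+m _ (edges k)) ⟩
             suc (edges k) + Δ * Δ * stars k                 ≡⟨ cong (_+ Δ * Δ * stars k) (stars≡1+edges k) ⟨
             stars k + Δ * Δ * stars k                       ≤⟨ +-monoˡ-≤ (Δ * Δ * stars k) (m≤m+n (stars k) (t * stars k)) ⟩
             suc t * stars k + Δ * Δ * stars k               ≤⟨ enough ⟩
             length xs                                       ∎)
      where open ≤-Reasoning
    ... | c , I , rest , perm , lenI , codes with same-palette I codes lenI | Unique-++⁻ I (Unique-resp-↭ perm u)
    ... | C , ofPal | uI , uR , I#R
      with build k I (trans lenI (sym (stars≡1+edges k))) uI ofPal S (λ i∈ → fresh (∈-resp-↭ (↭-sym perm) (∈-++⁺ˡ i∈)))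
    ... | H₁ , S₁ , ex₁ , _ , l₁ , r₁
      with harvest k t rest S₁ uR
             (λ i∈ → fresh-ext (λ i∈I → I#R (i∈I , i∈)) ex₁ (fresh (∈-resp-↭ (↭-sym perm) (∈-++⁺ʳ I i∈))))
             (+-cancelˡ-≤ (stars k) _ _ (begin
               stars k + (t * stars k + Δ * Δ * stars k)     ≡⟨ +-assoc (stars k) _ _ ⟨
               suc t * stars k + Δ * Δ * stars k             ≤⟨ enough ⟩
               length xs                                     ≡⟨ ↭-length perm ⟩
               length (I ++ rest)                            ≡⟨ length-++ I ⟩
               length I + length rest                        ≡⟨ cong (_+ length rest) (trans lenI (sym (stars≡1+edges k))) ⟩
               stars k + length rest                         ∎))
      where open ≤-Reasoning
    ... | H₂ , S₂ , l₂ , r₂ = H₂ , S₂ ,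
      trans l₂ (trans (cong (t * edges k +_) l₁) (x+[y+z] (t * edges k) (edges k) _)) ,
      ≤-trans (≤-reflexive (sym (x+[y+z] (t * forced k) (forced k) _))) (≤-trans (+-monoʳ-≤ (t * forced k) r₁) r₂)
      where
      x+[y+z] : ∀ x y z → x + (y + z) ≡ y + x + z
      x+[y+z] x y z = trans (sym (+-assoc x y z)) (cong (_+ z) (+-comm x y))

  -- The initial stars and their colouring.

  edge : Fin m × Fin p → Edge n
  edge (i , j) = leaf i j

  edge-injective : ∀ {q q′} → edge q ≡ edge q′ → q ≡ q′
  edge-injective eq with leaf-injective eq
  ... | refl , refl = refl

  -- The edges at centre `i` are leaf edges of star `i`, and their leaf indices are distinct
  -- elements of `Fin p`.
  deg-centre : ∀ qs → Unique qs → ∀ i → deg (map edge qs) (ctr i) ≤ p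
  deg-centre qs u i = ≤-trans (below qs) (≤-trans (≤-reflexive (sym (length-map proj₂ (at-i qs))))
      (injective⇒≤ {f = lookup (map proj₂ (at-i qs))} (λ {a} {b} → lookup-injective (distinct qs u) a b)))
    where
    at-i? : Decidable (λ (q : Fin m × Fin p) → proj₁ q ≡ i)
    at-i? q = proj₁ q ≟ i
    at-i : List (Fin m × Fin p) → List (Fin m × Fin p)
    at-i = filter at-i?
    below : ∀ qs → deg (map edge qs) (ctr i) ≤ length (at-i qs)
    below []       = z≤n
    below (q ∷ qs) with at-i? q
    ... | yes q≡i = ≤-trans (deg-step (edge q) (map edge qs) (ctr i))
                      (s≤s (below qs))
    ... | no  q≢i = ≤-trans (≤-reflexive (deg-skip (edge q) (map edge qs) (ctr i) (q≢i ∘ leaf-incident)))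
                      (below qs)
    distinct : ∀ qs → Unique qs → Unique (map proj₂ (at-i qs))
    distinct qs u = go (at-i qs) (All.all-filter at-i? qs) (Unique.filter⁺ at-i? u)
      where
      go : ∀ rs → All (λ q → proj₁ q ≡ i) rs → Unique rs → Unique (map proj₂ rs)
      go []       _            _          = []
      go (r ∷ rs) (refl ∷ eqs) (r∉ ∷ urs) =
        All.map⁺ (All.zipWith (λ { (eq , r≢) eq₂ → r≢ (cong₂ _,_ (sym eq) eq₂) }) (eqs , r∉)) ∷ go rs eqs urs

  -- Each insertion attaches a leaf that is still isolated, since the pairs are distinct and leaves
  -- belong to one star only.
  stars-valid : ∀ qs → Unique qs → ValidRun n Δ (map edge qs)
  stars-valid []             _          = empty
  stars-valid ((i , j) ∷ qs) u@(q∉ ∷ us) = insert (ctr i) (vtx i (suc j)) (stars-valid qs us)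
    (λ conn → 0≢suc (isolated-connected isolated conn))
    (≤-trans (deg-centre _ u i) (m≤n+m p 2))
    (≤-trans (deg-step (leaf i j) (map edge qs) _) (s≤s (≤-trans (≤-reflexive (deg-isolated _ _ isolated)) z≤n)))
    where
    0≢suc : ctr i ≢ vtx i (suc j)
    0≢suc eq with vtx-injective eq
    ... | _ , ()
    isolated : ∀ {e} → e ∈ map edge qs → ¬ Incident e (vtx i (suc j))
    isolated e∈ inc with ∈-map⁻ edge e∈
    isolated e∈ (inj₁ eq) | q , q∈ , refl with vtx-injective eq
    ... | _ , ()
    isolated e∈ (inj₂ eq) | q , q∈ , refl with vtx-injective eq
    ... | refl , refl = All.lookup q∉ q∈ refl

  pairs : List (Fin m × Fin p)
  pairs = cartesianProduct (allFin m) (allFin p)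

  pairs-unique : Unique pairs
  pairs-unique = Unique.cartesianProduct⁺ (Unique.allFin⁺ m) (Unique.allFin⁺ p)

  H₀ : History n
  H₀ = map edge pairs

  valid₀ : ValidRun n Δ H₀
  valid₀ = stars-valid pairs pairs-unique

  leaf∈H₀ : ∀ i j → leaf i j ∈ H₀
  leaf∈H₀ i j = ∈-map⁺ edge (∈-cartesianProduct⁺ (∈-allFin i) (∈-allFin j))

  κ₀ : Fin m → Fin p → Fin Δ
  κ₀ i j = col H₀ (proj₁ (∈⇒lookup (leaf∈H₀ i j)))

  frozen₀ : ∀ l i j → lookup H₀ l ≡ leaf i j → col H₀ l ≡ κ₀ i j
  frozen₀ l i j at = cong (col H₀) (lookup-injective (Unique.map⁺ edge-injective pairs-unique) _ _
    (trans at (sym (proj₂ (∈⇒lookup (leaf∈H₀ i j))))))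

  κ₀-injective : ∀ i → Injective (κ₀ i)
  κ₀-injective i {j} {j′} eq with ∈⇒lookup (leaf∈H₀ i j) | ∈⇒lookup (leaf∈H₀ i j′)
  ... | l , at | l′ , at′ with l ≟ l′
  ...   | yes refl = proj₂ (leaf-injective (trans (sym at) at′))
  ...   | no l≢l′  = ⊥-elim (proper H₀ valid₀ l l′ l≢l′ (ctr i)
                       (inj₁ (cong proj₁ at)) (inj₁ (cong proj₁ at′))
                       (trans (frozen₀ l i j at) (trans eq (sym (frozen₀ l′ i j′ at′)))))

  length-H₀ : length H₀ ≡ m * p
  length-H₀ = trans (length-map edge pairs) (trans (length-cartesianProduct (allFin m) (allFin p))
    (cong₂ _*_ (length-tabulate {n = m} id) (length-tabulate {n = p} id)))

  -- Leaf colours and missing pairs are read off the colouring of the finished stars, before any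
  -- link. Recourse during the star phase is dropped from the bound.
  adversary : ∀ k t → t * stars k + Δ * Δ * stars k ≤ m →
    ∃ λ H → ValidRun n Δ H × length H ≡ t * edges k + m * p × t * forced k ≤ totalRecourse A H
  adversary k t enough = go κ₀ frozen₀ (λ i → complement-pair (κ₀ i) (κ₀-injective i))
    where
    go : ∀ κ → (∀ l i j → lookup H₀ l ≡ leaf i j → col H₀ l ≡ κ i j) →
      (∀ i → ∃ λ C → (∀ j t → κ i j ≢ pick C t) × (∀ {t t′} → pick C t ≡ pick C t′ → t ≡ t′) ×
               (∀ c → (∃ λ t → c ≡ pick C t) ⊎ (∃ λ j → c ≡ κ i j))) →
      ∃ λ H → ValidRun n Δ H × length H ≡ t * edges k + m * p × t * forced k ≤ totalRecourse A H
    go κ frozen pal =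
      let H , S , len , rec = harvest k t (allFin m) state₀ (Unique.allFin⁺ m) (λ {i} _ → fresh₀ i)
                                (≤-trans enough (≤-reflexive (sym (length-tabulate {n = m} id))))
      in H , State.valid S , trans len (cong (t * edges k +_) length-H₀) , m+n≤o⇒m≤o _ rec
      where
      open Spines κ (λ i → proj₁ (pal i)) (λ i → proj₁ (proj₂ (pal i)))
        (λ i → proj₁ (proj₂ (proj₂ (pal i)))) (λ i → proj₂ (proj₂ (proj₂ (pal i))))
      state₀ : State H₀
      state₀ = record
        { valid = valid₀ ; leaves = leaf∈H₀ ; frozen = frozen
        ; kinds = λ e∈ → let (i , j) , _ , eq = ∈-map⁻ edge e∈ in inj₁ (i , j , eq) }
      fresh₀ : ∀ i → Fresh H₀ i
      fresh₀ i = deg-centre pairs pairs-unique i , closed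
        where
        closed : Closed H₀ [ i ]
        closed e∈ with ∈-map⁻ edge e∈
        ... | q , _ , refl = (λ x∈ → ∈⇒within (within⇒∈ x∈)) , (λ x∈ → ∈⇒within (within⇒∈ x∈))

-- Choice of parameters and final estimate.

theorem3p12 : ∃ λ (a : ℕ) → ∃ λ (b : ℕ) →
    ∀ (Δ : ℕ) → 3 ≤ Δ → ∀ (n : ℕ) → (A : ShiftAlg n Δ) →
    ∀ (L : ℕ) → 2 ^ L * Δ ^ 3 ≤ n →
    Σ (History n) λ H → ValidRun n Δ H × 1 ≤ length H ×
    length H * (L ∸ b) ≤ a * Δ * totalRecourse A H
-- For `L = 4 + k`, paths of level `2 + k` are built. Of the offset 4, two units are the shift in
-- `forced≥`, one comes from `stars k ≤ 2 ^ suc k` and one from taking twice as many stars as are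
-- grouped.
theorem3p12 = 4 , 4 , λ { _ (s≤s (s≤s (s≤s {n = q} z≤n))) n A L large → by-size q n A L large (4 ≤? L) }
  where
  by-size : ∀ q n (A : ShiftAlg n (3 + q)) L → 2 ^ L * (3 + q) ^ 3 ≤ n → Dec (4 ≤ L) →
    Σ (History n) λ H → ValidRun n (3 + q) H × 1 ≤ length H ×
    length H * (L ∸ 4) ≤ 4 * (3 + q) * totalRecourse A H
  -- Here `L ∸ 4` is zero, so any nonempty valid history will do.
  by-size q n A L large (no L<4) = one-edge n A
    (≤-trans (*-mono-≤ (m^n>0 2 L) (≤-trans (s≤s (s≤s z≤n)) (m≤m*n (3 + q) ((3 + q) ^ 2)))) large)
    where
    one-edge : ∀ n (A : ShiftAlg n (3 + q)) → 2 ≤ n → Σ (History n) λ H → ValidRun n (3 + q) H × 1 ≤ length H ×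
      length H * (L ∸ 4) ≤ 4 * (3 + q) * totalRecourse A H
    one-edge _ A (s≤s (s≤s {n = n} z≤n)) = [ zero , suc zero ] ,
      insert zero (suc zero) empty (λ conn → 0≢1 (isolated-connected (λ ()) conn)) (s≤s z≤n) (s≤s z≤n) ,
      ≤-refl , ≤-trans (≤-reflexive (cong (1 *_) (m≤n⇒m∸n≡0 (≤-pred (m≤n⇒m≤1+n (≰⇒> L<4)))))) z≤n
      where
      0≢1 : Fin.zero {suc n} ≢ suc zero
      0≢1 ()
  by-size q n A _ large (yes (s≤s (s≤s (s≤s (s≤s {n = k} z≤n))))) = conclude
      (Adversary.adversary A vtx vtx-injective (2 + k) N ≤-refl)
    where
    open ≤-Reasoning
    p Δ N s m P Q : ℕ
    p = 1 + q
    Δ = 2 + p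
    N = Δ * Δ
    s = stars (2 + k)
    -- One half is harvested in `N` groups, the other half is the reserve that `harvest` demands.
    m = N * s + N * s
    P = 2 ^ (2 + k)
    Q = 2 ^ (3 + k)
    fits : m * suc p ≤ n
    fits = begin
      (N * s + N * s) * suc p      ≤⟨ *-mono-≤ (+-mono-≤ N*s≤ N*s≤) (n≤1+n (suc p)) ⟩
      (N * Q + N * Q) * Δ          ≡⟨ arith Δ Q ⟩
      2 * Q * Δ ^ 3                ≤⟨ large ⟩
      n                            ∎
      where
      N*s≤ : N * s ≤ N * Q
      N*s≤ = *-monoʳ-≤ N (stars≤ (2 + k))
      arith : ∀ D Q → (D * D * Q + D * D * Q) * D ≡ 2 * Q * (D * (D * (D * 1)))
      arith = solve-∀
    vtx : Fin m → Fin (suc p) → Fin n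
    vtx i j = inject≤ (combine i j) fits
    vtx-injective : ∀ {i i′ j j′} → vtx i j ≡ vtx i′ j′ → i ≡ i′ × j ≡ j′
    vtx-injective eq = combine-injective _ _ _ _ (inject≤-injective fits fits _ _ eq)
    conclude : (∃ λ H → ValidRun n Δ H × length H ≡ N * edges (2 + k) + m * p ×
                 N * forced (2 + k) ≤ totalRecourse A H) →
      Σ (History n) λ H → ValidRun n Δ H × 1 ≤ length H × length H * k ≤ 4 * Δ * totalRecourse A H
    conclude (H , valid , len , rec) = H , valid , nonempty , (begin
        length H * k                                   ≡⟨ cong (_* k) len ⟩
        (N * edges (2 + k) + (N * s + N * s) * p) * k  ≤⟨ *-monoˡ-≤ k (+-mono-≤ (*-monoʳ-≤ N edges≤Q)
                                                           (*-monoˡ-≤ p (+-mono-≤ N*s≤ N*s≤))) ⟩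
        -- As `Q = 2 * P`, the length is at most `(2 + 4 * p) * (N * P)`; the added term contributes
        -- `6 * (N * P)` and completes the factor to `4 * Δ`.
        (N * Q + (N * Q + N * Q) * p) * k              ≤⟨ m≤m+n _ (3 * (N * Q) * k) ⟩
        (N * Q + (N * Q + N * Q) * p) * k
          + 3 * (N * Q) * k                            ≡⟨ arith p N P k ⟩
        4 * Δ * (N * (k * P))                          ≤⟨ *-monoʳ-≤ (4 * Δ) (*-monoʳ-≤ N (m+n≤o⇒m≤o (k * P) (forced≥ k))) ⟩
        4 * Δ * (N * forced (2 + k))                   ≤⟨ *-monoʳ-≤ (4 * Δ) rec ⟩
        4 * Δ * totalRecourse A H                      ∎)
      where
      N*s≤ : N * s ≤ N * Q
      N*s≤ = *-monoʳ-≤ N (stars≤ (2 + k))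
      edges≤Q : edges (2 + k) ≤ Q
      edges≤Q = ≤-trans (m≤m+n _ 2) (≤-reflexive (edges+2 (2 + k)))
      nonempty : 1 ≤ length H
      nonempty = ≤-trans (s≤s z≤n) (≤-reflexive (sym len))
      arith : ∀ p N P k → (N * (2 * P) + (N * (2 * P) + N * (2 * P)) * p) * k + 3 * (N * (2 * P)) * k
                          ≡ 4 * (2 + p) * (N * (k * P))
      arith = solve-∀
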